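{- Let $a,b,c$ be symbols of rank $0$, $1$ and $2$, respectively. There is a family of trees $(t_n)_{n\ge1}$ with all labels in $\{a,b,c\}$ and a constant $C>0$ such that: $|t_n|\in\Theta(n)$; for every $n$ and every subtree $s$ of $t_n$ (rooted at any node), the depth of $s$ is at most $C\log_2(|s|+1)$; and the minimal dag of $t_n$ has $\Omega\big(\frac{n\log\log n}{\log n}\big)$ nodes.
   Context: Trees are finite rooted ordered trees whose nodes are labelled by ranked symbols, a node labelled by a symbol of rank $k$ having exactly $k$ ordered children; $|t|$ is the number of nodes and the depth is the maximal number of edges on a root-to-leaf path. The minimal dag of a tree has one node for each isomorphism class (as labelled ordered trees) of subtrees; its size is its number of nodes. -}

module Defs where

open import Data.List using (List; []; _∷_; _++_; length; deduplicate)
open import Data.Nat using (ℕ; suc; _+_; _*_; _^_; _⊔_; _≤_; _<_; NonZero)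
open import Data.Product using (_×_; ∃-syntax)
open import Relation.Binary.Definitions using (DecidableEquality)
open import Relation.Binary.PropositionalEquality using (refl)
open import Relation.Nullary using (yes; no)

-- Trees over the ranked alphabet with a of rank 0, b of rank 1, c of rank 2.
-- Such trees are isomorphic as labelled ordered trees iff they are
-- propositionally equal.
data Tree : Set where
  a : Tree
  b : Tree → Tree
  c : Tree → Tree → Tree

size : Tree → ℕ
size a       = 1
size (b t)   = suc (size t)
size (c l r) = suc (size l + size r)

depth : Tree → ℕ
depth a       = 0
depth (b t)   = suc (depth t)
depth (c l r) = suc (depth l ⊔ depth r)

-- One entry for each node of the tree: the full subtree rooted there.
subtrees : Tree → List Tree
subtrees a       = a ∷ []
subtrees (b t)   = b t ∷ subtrees t
subtrees (c l r) = c l r ∷ (subtrees l ++ subtrees r)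

_≟_ : DecidableEquality Tree
a       ≟ a         = yes refl
a       ≟ b _       = no λ ()
a       ≟ c _ _     = no λ ()
b _     ≟ a         = no λ ()
b t     ≟ b t′ with t ≟ t′
... | yes refl      = yes refl
... | no  t≢t′      = no λ { refl → t≢t′ refl }
b _     ≟ c _ _     = no λ ()
c _ _   ≟ a         = no λ ()
c _ _   ≟ b _       = no λ ()
c l r   ≟ c l′ r′ with l ≟ l′ | r ≟ r′
... | yes refl | yes refl = yes refl
... | no  l≢l′ | _        = no λ { refl → l≢l′ refl }
... | yes _    | no  r≢r′ = no λ { refl → r≢r′ refl }

dagNodes : Tree → List Tree
dagNodes t = deduplicate _≟_ (subtrees t)

dagSize : Tree → ℕ
dagSize t = length (dagNodes t)

-- Multiplicative constants are natural numbers.  A lower bound f n ≥ ε · g n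
-- with ε > 0 is written g n ≤ k · f n with k ≥ 1/ε, which loses nothing since
-- the constants are existentially quantified.
_∈Θ_ : (ℕ → ℕ) → (ℕ → ℕ) → Set
f ∈Θ g = ∃[ k ] ∃[ K ] ∃[ N ] 0 < k × 0 < K ×
         (∀ n → N ≤ n → g n ≤ k * f n × f n ≤ K * g n)

-- For m ≥ 1: the real inequality d ≤ C · log₂ m, exponentiated.
_≤_·log₂_ : ℕ → ℕ → ℕ → Set
d ≤ C ·log₂ m = 2 ^ d ≤ m ^ C

-- Nonnegative rationals as (unnormalised) fractions; they are used to
-- approximate the real numbers log₂ n and log₂ (log₂ n).
record Frac : Set where
  constructor _/_
  field
    num         : ℕ
    den         : ℕ
    .{{den≢0}}  : NonZero den

fromℕ : ℕ → Frac
fromℕ n = n / 1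

-- p/q ≤ log₂ (x/y)  iff  2^p ≤ (x/y)^q, and likewise for the reverse.
_≤log₂_ : Frac → Frac → Set
(p / q) ≤log₂ (x / y) = 2 ^ p * y ^ q ≤ x ^ q

log₂_≤_ : Frac → Frac → Set
log₂ (x / y) ≤ (p / q) = x ^ q ≤ 2 ^ p * y ^ q

_·_≤_·_ : ℕ → Frac → ℕ → Frac → Set
m · (p / q) ≤ m′ · (p′ / q′) = m * p * q′ ≤ m′ * p′ * q

-- n · log₂ (log₂ n) ≤ m · log₂ n as an inequality between real numbers
-- (n ≥ 2): log₂ (log₂ n) is the supremum of the y with y ≤ log₂ x for some
-- rational x ≤ log₂ n, and log₂ n is the infimum of the rationals z above it.
-- (For n ≥ 2 log₂ (log₂ n) ≥ 0, so nonnegative rationals are enough.)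
_·loglog_≤_·log_ : ℕ → ℕ → ℕ → ℕ → Set
n ·loglog i ≤ m ·log j =
  ∀ (x y z : Frac) → x ≤log₂ fromℕ i → y ≤log₂ x → log₂ fromℕ j ≤ z →
  n · y ≤ m · z

-- f n ∈ Ω (n · log log n / log n), with the denominator cleared.
_∈Ω[n·loglog-n/log-n] : (ℕ → ℕ) → Set
f ∈Ω[n·loglog-n/log-n] =
  ∃[ k ] ∃[ N ] 0 < k ×
  (∀ n → N ≤ n → n ·loglog n ≤ (k * f n) ·log n)

{-# OPTIONS --safe #-}

-- Let L = ⌊log₂ n⌋, k = ⌊log₂ L⌋ and h = L − k.  The n-th tree is a perfect
-- binary tree of height h; its i-th leaf carries b^k applied to a perfect binary
-- tree of height k + 1 whose leaves, a or b a, spell the bits of i.  Since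
-- h ≤ 2^(k+1), these 2^h blocks are pairwise distinct, so with their chains of
-- unary nodes they contribute (k+1)·2^h distinct subtrees, where
-- 2^h ≈ n / log n and k + 1 ≈ log log n.  A block has size Θ(2^k) and depth
-- O(k), which keeps the depth of every subtree logarithmic and the size of the
-- whole tree Θ(n).
module Submission where

open import Defs
open import Data.Fin using (Fin; toℕ; remQuot; combine)
open import Data.Fin.Properties
  using (toℕ<n; toℕ-injective; combine-remQuot; injective⇒≤)
open import Data.List.Membership.Propositional using (_∈_)
open import Data.List.Membership.Propositional.Properties
  using (∈-++⁺ˡ; ∈-++⁺ʳ; ∈-deduplicate⁺)
open import Data.List.Membership.Setoid.Properties using (index-injective)
open import Data.List.Relation.Unary.All as All using (All; []; _∷_)
import Data.List.Relation.Unary.All.Properties as All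
open import Data.List.Relation.Unary.Any using (here; there)
open import Data.Nat using (ℕ; zero; suc; _+_; _*_; _∸_; _^_; _%_; _≤_; _<_;
  _<?_; _≤′_; ≤′-refl; ≤′-step; NonZero; ⌊_/2⌋; z≤n; s≤s; z<s; s≤s⁻¹)
  renaming (_/_ to infixl 7 _div_)
open import Data.Nat.DivMod using (m≡m%n+[m/n]*n; m<n*o⇒m/o<n; m%n<n)
open import Data.Nat.Logarithm using (⌊log₂_⌋; ⌊log₂⌋-mono-≤; ⌊log₂[2^n]⌋≡n)
open import Data.Nat.Logarithm.Core using (⌊log2⌋)
open import Data.Nat.Induction using (<-wellFounded)
open import Data.Nat.Properties hiding (_≟_)
open import Data.Nat.Tactic.RingSolver using (solve-∀)
open import Data.Product using (Σ-syntax; _×_; _,_; proj₁; proj₂; uncurry)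
open import Function using (_∘_)
open import Function.Definitions using (Injective)
open import Induction.WellFounded using (Acc; acc)
open import Relation.Binary.PropositionalEquality
  using (_≡_; refl; sym; trans; cong; cong₂; subst; setoid)
open import Relation.Nullary using (yes; no)

-- Powers and logarithms

^-distribʳ-* : ∀ m n o → (m * n) ^ o ≡ m ^ o * n ^ o
^-distribʳ-* m n zero    = refl
^-distribʳ-* m n (suc o) =
  trans (cong (m * n *_) (^-distribʳ-* m n o)) ([m*n]*[o*p]≡[m*o]*[n*p] m n _ _)

^-cancelʳ-≤ : ∀ m {n o} → 1 < m → m ^ n ≤ m ^ o → n ≤ o
^-cancelʳ-≤ m 1<m mⁿ≤mᵒ = ≮⇒≥ λ o<n → ≤⇒≯ mⁿ≤mᵒ (^-monoʳ-< m 1<m o<n)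

n<2^n : ∀ n → n < 2 ^ n
n<2^n zero    = z<s
n<2^n (suc n) = begin
  1 + suc n      ≤⟨ +-mono-≤ (m^n>0 2 n) (n<2^n n) ⟩
  2 ^ n + 2 ^ n  ≡⟨ cong (2 ^ n +_) (+-identityʳ (2 ^ n)) ⟨
  2 ^ suc n      ∎
  where open ≤-Reasoning

2*⌊n/2⌋≤n : ∀ n → 2 * ⌊ n /2⌋ ≤ n
2*⌊n/2⌋≤n 0             = z≤n
2*⌊n/2⌋≤n 1             = z≤n
2*⌊n/2⌋≤n (suc (suc n)) = begin
  2 * suc ⌊ n /2⌋  ≡⟨ *-suc 2 ⌊ n /2⌋ ⟩
  2 + 2 * ⌊ n /2⌋  ≤⟨ +-monoʳ-≤ 2 (2*⌊n/2⌋≤n n) ⟩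
  2 + n            ∎
  where open ≤-Reasoning

-- Keeping the accessibility proof as an argument lets the induction follow the recursion of
-- `⌊log2⌋` by halving.
2^⌊log2⌋≤n : ∀ n (rec : Acc _<_ n) → 1 ≤ n → 2 ^ ⌊log2⌋ n rec ≤ n
2^⌊log2⌋≤n 1             _        _ = ≤-refl
2^⌊log2⌋≤n (suc (suc n)) (acc rs) _ =
  ≤-trans (*-monoʳ-≤ 2 (2^⌊log2⌋≤n (suc ⌊ n /2⌋) _ z<s)) (2*⌊n/2⌋≤n (2 + n))

2^⌊log₂n⌋≤n : ∀ n → 1 ≤ n → 2 ^ ⌊log₂ n ⌋ ≤ n
2^⌊log₂n⌋≤n n = 2^⌊log2⌋≤n n (<-wellFounded n)

n<2^1+⌊log₂n⌋ : ∀ n → n < 2 ^ suc ⌊log₂ n ⌋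
n<2^1+⌊log₂n⌋ n = ≰⇒> λ 2^≤n → 1+n≰n
  (subst (_≤ ⌊log₂ n ⌋) (⌊log₂[2^n]⌋≡n (suc ⌊log₂ n ⌋)) (⌊log₂⌋-mono-≤ 2^≤n))

-- From p/q ≤ log₂ (x/y) ≤ e: raise the bound on x/y to the power q, cancel `y ^ q` and compare
-- exponents of 2. This trades the rational approximations of logarithms for integer ones; `log₂≤⇒≤`
-- is the dual.
≤log₂⇒≤ : ∀ e {p q x y} .{{_ : NonZero q}} .{{_ : NonZero y}} →
          (p / q) ≤log₂ (x / y) → x ≤ 2 ^ e * y → p ≤ e * q
≤log₂⇒≤ e {p} {q} {x} {y} p/q≤ x≤ = ^-cancelʳ-≤ 2 (s≤s z<s)
  (*-cancelʳ-≤ (2 ^ p) (2 ^ (e * q)) (y ^ q) {{m^n≢0 y q}} (begin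
    2 ^ p * y ^ q        ≤⟨ p/q≤ ⟩
    x ^ q                ≤⟨ ^-monoˡ-≤ q x≤ ⟩
    (2 ^ e * y) ^ q      ≡⟨ ^-distribʳ-* (2 ^ e) y q ⟩
    (2 ^ e) ^ q * y ^ q  ≡⟨ cong (_* y ^ q) (^-*-assoc 2 e q) ⟩
    2 ^ (e * q) * y ^ q  ∎))
  where open ≤-Reasoning

log₂≤⇒≤ : ∀ e {p q x y} .{{_ : NonZero q}} .{{_ : NonZero y}} →
          log₂ (x / y) ≤ (p / q) → 2 ^ e * y ≤ x → e * q ≤ p
log₂≤⇒≤ e {p} {q} {x} {y} ≤p/q ≤x = ^-cancelʳ-≤ 2 (s≤s z<s)
  (*-cancelʳ-≤ (2 ^ (e * q)) (2 ^ p) (y ^ q) {{m^n≢0 y q}} (begin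
    2 ^ (e * q) * y ^ q  ≡⟨ cong (_* y ^ q) (^-*-assoc 2 e q) ⟨
    (2 ^ e) ^ q * y ^ q  ≡⟨ ^-distribʳ-* (2 ^ e) y q ⟨
    (2 ^ e * y) ^ q      ≤⟨ ^-monoˡ-≤ q ≤x ⟩
    x ^ q                ≤⟨ ≤p/q ⟩
    2 ^ p * y ^ q        ∎))
  where open ≤-Reasoning

-- Binary digits

bit : ℕ → ℕ → ℕ
bit i zero    = i % 2
bit i (suc j) = bit (i div 2) j

bit<2 : ∀ i j → bit i j < 2
bit<2 i zero    = m%n<n i 2
bit<2 i (suc j) = bit<2 (i div 2) j

-- Induction on `h`: bit 0 is the remainder modulo 2, and the remaining bits determine the quotient.
bit-injective : ∀ h {i i′} → i < 2 ^ h → i′ < 2 ^ h →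
                (∀ j → j < h → bit i j ≡ bit i′ j) → i ≡ i′
bit-injective zero    (s≤s z≤n) (s≤s z≤n) _ = refl
bit-injective (suc h) {i} {i′} i< i′< eq = begin
  i                       ≡⟨ m≡m%n+[m/n]*n i 2 ⟩
  i % 2 + i div 2 * 2     ≡⟨ cong₂ (λ r q → r + q * 2) (eq 0 z<s)
                               (bit-injective h (half< i<) (half< i′<)
                                 (λ j j<h → eq (suc j) (s≤s j<h))) ⟩
  i′ % 2 + i′ div 2 * 2   ≡⟨ m≡m%n+[m/n]*n i′ 2 ⟨
  i′                      ∎
  where
  open Relation.Binary.PropositionalEquality.≡-Reasoning
  half< : ∀ {m} → m < 2 ^ suc h → m div 2 < 2 ^ h
  half< {m} m< = m<n*o⇒m/o<n (subst (m <_) (*-comm 2 (2 ^ h)) m<)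

-- Subtrees and dags

self∈subtrees : ∀ t → t ∈ subtrees t
self∈subtrees a       = here refl
self∈subtrees (b _)   = here refl
self∈subtrees (c _ _) = here refl

-- Sending `i` to the position of `f i` in the deduplicated list is an injection into the positions
-- of that list.
injective⇒≤dagSize : ∀ {m} t (f : Fin m → Tree) → Injective _≡_ _≡_ f →
                     (∀ i → f i ∈ subtrees t) → m ≤ dagSize t
injective⇒≤dagSize t f f-inj f∈ = injective⇒≤
  (f-inj ∘ index-injective (setoid Tree) (f∈dag _) (f∈dag _))
  where
  f∈dag : ∀ i → f i ∈ dagNodes t
  f∈dag i = ∈-deduplicate⁺ _≟_ (f∈ i)

-- Shallow trees and unary chains

Shallow : Tree → Set
Shallow t = depth t ≤ 2 ·log₂ suc (size t)

-- The exponent `e` acts as a certificate linking depth and size. All later depth bounds consist in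
-- supplying a suitable `e`.
shallow : ∀ e t → depth t ≤ e * 2 → 2 ^ e ≤ suc (size t) → Shallow t
shallow e t d≤ s≥ = begin
  2 ^ depth t       ≤⟨ ^-monoʳ-≤ 2 d≤ ⟩
  2 ^ (e * 2)       ≡⟨ ^-*-assoc 2 e 2 ⟨
  (2 ^ e) ^ 2       ≤⟨ ^-monoˡ-≤ 2 s≥ ⟩
  suc (size t) ^ 2  ∎
  where open ≤-Reasoning

chain : ℕ → Tree → Tree
chain zero    t = t
chain (suc j) t = b (chain j t)

size-chain : ∀ j t → size (chain j t) ≡ j + size t
size-chain zero    t = refl
size-chain (suc j) t = cong suc (size-chain j t)

depth-chain : ∀ j t → depth (chain j t) ≡ j + depth t
depth-chain zero    t = refl
depth-chain (suc j) t = cong suc (depth-chain j t)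

chain-injectiveˡ : ∀ i j t → chain i t ≡ chain j t → i ≡ j
chain-injectiveˡ i j t eq = +-cancelʳ-≡ (size t) i j
  (trans (sym (size-chain i t)) (trans (cong size eq) (size-chain j t)))

-- The first binary node marks the end of the chain, so both the length and the tree below it can be
-- recovered.
chain-c-injective : ∀ i j {l r l′ r′} → chain i (c l r) ≡ chain j (c l′ r′) →
                    i ≡ j × c l r ≡ c l′ r′
chain-c-injective zero    zero    eq   = refl , eq
chain-c-injective (suc i) (suc j) eq with chain-c-injective i j (b-injective eq)
  where
  b-injective : ∀ {t u} → b t ≡ b u → t ≡ u
  b-injective refl = refl
... | i≡j , t≡u = cong suc i≡j , t≡u

chain∈subtrees : ∀ {i j} t → i ≤′ j → chain i t ∈ subtrees (chain j t)
chain∈subtrees t ≤′-refl       = self∈subtrees _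
chain∈subtrees t (≤′-step i≤j) = there (chain∈subtrees t i≤j)

-- One certificate serves every node of the chain: the depths stay below that of the whole chain,
-- and the sizes are at least that of `t`.
shallow-chain : ∀ e j t → j + depth t ≤ e * 2 → 2 ^ e ≤ suc (size t) →
                All Shallow (subtrees t) → All Shallow (subtrees (chain j t))
shallow-chain e zero    t _  _  all = all
shallow-chain e (suc j) t d≤ s≥ all =
  shallow e (chain (suc j) t)
    (≤-trans (≤-reflexive (depth-chain (suc j) t)) d≤)
    (≤-trans s≥ (s≤s (≤-trans (m≤n+m (size t) (suc j))
                              (≤-reflexive (sym (size-chain (suc j) t))))))
  ∷ shallow-chain e j t (≤-trans (n≤1+n _) d≤) s≥ all

-- Perfect binary trees with prescribed leaves

perfect : ℕ → (ℕ → Tree) → Tree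
perfect zero    f = f 0
perfect (suc d) f = c (perfect d f) (perfect d (f ∘ (2 ^ d +_)))

2^[1+d]*m : ∀ d m → 2 ^ suc d * m ≡ 2 ^ d * m + 2 ^ d * m
2^[1+d]*m d m = lemma (2 ^ d) m
  where
  lemma : ∀ x m → 2 * x * m ≡ x * m + x * m
  lemma = solve-∀

depth-perfect-≤ : ∀ d m f → (∀ i → depth (f i) ≤ m) → depth (perfect d f) ≤ d + m
depth-perfect-≤ zero    m f f≤ = f≤ 0
depth-perfect-≤ (suc d) m f f≤ =
  s≤s (⊔-lub (depth-perfect-≤ d m f f≤) (depth-perfect-≤ d m _ (f≤ ∘ (2 ^ d +_))))

-- Size plus one is additive at binary nodes, so a bound on it at the leaves is simply multiplied by
-- the number of leaves. The upper bound below works the same way.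
size-perfect-≥ : ∀ d m f → (∀ i → m ≤ suc (size (f i))) →
                 2 ^ d * m ≤ suc (size (perfect d f))
size-perfect-≥ zero    m f m≤ = ≤-trans (≤-reflexive (*-identityˡ m)) (m≤ 0)
size-perfect-≥ (suc d) m f m≤ = begin
  2 ^ suc d * m          ≡⟨ 2^[1+d]*m d m ⟩
  2 ^ d * m + 2 ^ d * m  ≤⟨ +-mono-≤ (size-perfect-≥ d m f m≤)
                              (size-perfect-≥ d m _ (m≤ ∘ (2 ^ d +_))) ⟩
  suc l + suc r          ≡⟨ cong suc (+-suc l r) ⟩
  suc (suc (l + r))      ∎
  where
  open ≤-Reasoning
  l = size (perfect d f)
  r = size (perfect d (f ∘ (2 ^ d +_)))

size-perfect-≤ : ∀ d m f → (∀ i → suc (size (f i)) ≤ m) →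
                 suc (size (perfect d f)) ≤ 2 ^ d * m
size-perfect-≤ zero    m f ≤m = ≤-trans (≤m 0) (≤-reflexive (sym (*-identityˡ m)))
size-perfect-≤ (suc d) m f ≤m = begin
  suc (suc (l + r))      ≡⟨ cong suc (+-suc l r) ⟨
  suc l + suc r          ≤⟨ +-mono-≤ (size-perfect-≤ d m f ≤m)
                              (size-perfect-≤ d m _ (≤m ∘ (2 ^ d +_))) ⟩
  2 ^ d * m + 2 ^ d * m  ≡⟨ 2^[1+d]*m d m ⟨
  2 ^ suc d * m          ∎
  where
  open ≤-Reasoning
  l = size (perfect d f)
  r = size (perfect d (f ∘ (2 ^ d +_)))

-- Each binary level doubles the lower bound on size plus one, raising the certificate by 1 and the
-- permitted depth by 2, while the depth grows only by 1.
shallow-perfect : ∀ d e f → (∀ i → depth (f i) ≤ e * 2) →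
                  (∀ i → 2 ^ e ≤ suc (size (f i))) →
                  (∀ i → All Shallow (subtrees (f i))) →
                  All Shallow (subtrees (perfect d f))
shallow-perfect zero    e f d≤ s≥ all = all 0
shallow-perfect (suc d) e f d≤ s≥ all =
  shallow (suc d + e) (perfect (suc d) f) depth≤ size≥
  ∷ All.++⁺ (shallow-perfect d e f d≤ s≥ all)
            (shallow-perfect d e _ (d≤ ∘ (2 ^ d +_)) (s≥ ∘ (2 ^ d +_)) (all ∘ (2 ^ d +_)))
  where
  open ≤-Reasoning
  depth≤ : depth (perfect (suc d) f) ≤ (suc d + e) * 2
  depth≤ = begin
    depth (perfect (suc d) f)  ≤⟨ depth-perfect-≤ (suc d) (e * 2) f d≤ ⟩
    suc d + e * 2              ≤⟨ +-monoˡ-≤ (e * 2) (m≤m*n (suc d) 2) ⟩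
    suc d * 2 + e * 2          ≡⟨ *-distribʳ-+ 2 (suc d) e ⟨
    (suc d + e) * 2            ∎
  size≥ : 2 ^ (suc d + e) ≤ suc (size (perfect (suc d) f))
  size≥ = begin
    2 ^ (suc d + e)                 ≡⟨ ^-distribˡ-+-* 2 (suc d) e ⟩
    2 ^ suc d * 2 ^ e               ≤⟨ size-perfect-≥ (suc d) (2 ^ e) f s≥ ⟩
    suc (size (perfect (suc d) f))  ∎

split-index : ∀ {ℓ} (P : ℕ → Set ℓ) d → (∀ i → i < 2 ^ d → P i) →
              (∀ i → i < 2 ^ d → P (2 ^ d + i)) → ∀ i → i < 2 ^ suc d → P i
split-index P d lo hi i i< with i <? 2 ^ d
... | yes i<2^d = lo i i<2^d
... | no  i≮2^d = subst P (m+[n∸m]≡n (≮⇒≥ i≮2^d)) (hi (i ∸ 2 ^ d) i∸<)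
  where
  open ≤-Reasoning
  i∸< : i ∸ 2 ^ d < 2 ^ d
  i∸< = +-cancelˡ-< (2 ^ d) _ _ (begin-strict
    2 ^ d + (i ∸ 2 ^ d)  ≡⟨ m+[n∸m]≡n (≮⇒≥ i≮2^d) ⟩
    i                    <⟨ i< ⟩
    2 ^ suc d            ≡⟨ cong (2 ^ d +_) (+-identityʳ (2 ^ d)) ⟩
    2 ^ d + 2 ^ d        ∎)

∈-subtrees-perfect : ∀ d f {s} i → i < 2 ^ d → s ∈ subtrees (f i) →
                     s ∈ subtrees (perfect d f)
∈-subtrees-perfect zero    f zero    _ s∈ = s∈
∈-subtrees-perfect zero    f (suc _) (s≤s ())
∈-subtrees-perfect (suc d) f {s} = split-index (λ i → s ∈ subtrees (f i) → _) d
  (λ i i< s∈ → there (∈-++⁺ˡ (∈-subtrees-perfect d f i i< s∈)))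
  (λ i i< s∈ → there (∈-++⁺ʳ (subtrees (perfect d f)) (∈-subtrees-perfect d _ i i< s∈)))

perfect-injective : ∀ d f g → perfect d f ≡ perfect d g → ∀ i → i < 2 ^ d → f i ≡ g i
perfect-injective zero    f g eq zero    _ = eq
perfect-injective zero    f g eq (suc _) (s≤s ())
perfect-injective (suc d) f g eq = split-index (λ i → f i ≡ g i) d
  (perfect-injective d f g (proj₁ (c-injective eq)))
  (perfect-injective d _ _ (proj₂ (c-injective eq)))
  where
  c-injective : ∀ {l r l′ r′} → c l r ≡ c l′ r′ → l ≡ l′ × r ≡ r′
  c-injective refl = refl , refl

-- The trees of the family

leaf : ℕ → ℕ → Tree
leaf i j = chain (bit i j) a

-- The height `suc k` is positive, so the root is a `c` and `chain-c-injective` applies.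
code : ℕ → ℕ → Tree
code k i = perfect (suc k) (leaf i)

block : ℕ → ℕ → Tree
block k i = chain k (code k i)

comb : ℕ → ℕ → Tree
comb h k = perfect h (block k)

depth-leaf-≤ : ∀ i j → depth (leaf i j) ≤ 1
depth-leaf-≤ i j = begin
  depth (leaf i j)  ≡⟨ depth-chain (bit i j) a ⟩
  bit i j + 0       ≡⟨ +-identityʳ (bit i j) ⟩
  bit i j           ≤⟨ s≤s⁻¹ (bit<2 i j) ⟩
  1                 ∎
  where open ≤-Reasoning

size-leaf : ∀ i j → suc (size (leaf i j)) ≡ 2 + bit i j
size-leaf i j = cong suc (trans (size-chain (bit i j) a) (+-comm (bit i j) 1))

size-leaf-≥ : ∀ i j → 2 ≤ suc (size (leaf i j))
size-leaf-≥ i j = ≤-trans (m≤m+n 2 (bit i j)) (≤-reflexive (sym (size-leaf i j)))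

size-leaf-≤ : ∀ i j → suc (size (leaf i j)) ≤ 3
size-leaf-≤ i j = ≤-trans (≤-reflexive (size-leaf i j)) (s≤s (bit<2 i j))

size-code-≥ : ∀ k i → 2 ^ (2 + k) ≤ suc (size (code k i))
size-code-≥ k i = begin
  2 ^ (2 + k)            ≡⟨ *-comm 2 (2 ^ suc k) ⟩
  2 ^ suc k * 2          ≤⟨ size-perfect-≥ (suc k) 2 (leaf i) (size-leaf-≥ i) ⟩
  suc (size (code k i))  ∎
  where open ≤-Reasoning

k+depth-code-≤ : ∀ k i → k + depth (code k i) ≤ (2 + k) * 2
k+depth-code-≤ k i = begin
  k + depth (code k i)  ≤⟨ +-monoʳ-≤ k (depth-perfect-≤ (suc k) 1 _ (depth-leaf-≤ i)) ⟩
  k + (suc k + 1)       ≤⟨ m≤m+n _ 2 ⟩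
  k + (suc k + 1) + 2   ≡⟨ lemma k ⟩
  (2 + k) * 2           ∎
  where
  open ≤-Reasoning
  lemma : ∀ k → k + (suc k + 1) + 2 ≡ (2 + k) * 2
  lemma = solve-∀

code-injective : ∀ h k {i i′} → h ≤ 2 ^ suc k → i < 2 ^ h → i′ < 2 ^ h →
                 code k i ≡ code k i′ → i ≡ i′
code-injective h k {i} {i′} h≤ i< i′< eq = bit-injective h i< i′< λ j j<h →
  chain-injectiveˡ (bit i j) (bit i′ j) a
    (perfect-injective (suc k) (leaf i) (leaf i′) eq j (<-≤-trans j<h h≤))

depth-block-≤ : ∀ k i → depth (block k i) ≤ (2 + k) * 2
depth-block-≤ k i =
  ≤-trans (≤-reflexive (depth-chain k (code k i))) (k+depth-code-≤ k i)

size-block-≥ : ∀ k i → 2 ^ (2 + k) ≤ suc (size (block k i))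
size-block-≥ k i = ≤-trans (size-code-≥ k i) (s≤s
  (≤-trans (m≤n+m (size (code k i)) k) (≤-reflexive (sym (size-chain k (code k i))))))

-- The factor is 7 = 1 + 6: the chain adds `k`, less than `2 ^ k`, and the code has `2 ^ suc k`
-- leaves, each contributing at most 3.
size-block-≤ : ∀ k i → suc (size (block k i)) ≤ 7 * 2 ^ k
size-block-≤ k i = begin
  suc (size (block k i))     ≡⟨ cong suc (size-chain k (code k i)) ⟩
  suc (k + size (code k i))  ≡⟨ +-suc k (size (code k i)) ⟨
  k + suc (size (code k i))  ≤⟨ +-mono-≤ (<⇒≤ (n<2^n k))
                                  (size-perfect-≤ (suc k) 3 (leaf i) (size-leaf-≤ i)) ⟩
  2 ^ k + 2 ^ suc k * 3      ≡⟨ lemma (2 ^ k) ⟩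
  7 * 2 ^ k                  ∎
  where
  open ≤-Reasoning
  lemma : ∀ x → x + 2 * x * 3 ≡ 7 * x
  lemma = solve-∀

shallow-block : ∀ k i → All Shallow (subtrees (block k i))
shallow-block k i =
  shallow-chain (2 + k) k (code k i) (k+depth-code-≤ k i) (size-code-≥ k i)
    -- Certificate 1 suffices at a leaf: depth at most 1, size plus one at least 2.
    (shallow-perfect (suc k) 1 (leaf i)
      (λ j → ≤-trans (depth-leaf-≤ i j) (n≤1+n 1)) (size-leaf-≥ i)
      (λ j → shallow-chain 1 (bit i j) a
        (≤-trans (≤-reflexive (+-identityʳ (bit i j))) (<⇒≤ (bit<2 i j)))
        ≤-refl (≤-trans z<s (n≤1+n 3) ∷ [])))

shallow-comb : ∀ h k → All Shallow (subtrees (comb h k))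
shallow-comb h k = shallow-perfect h (2 + k) (block k)
  (depth-block-≤ k) (size-block-≥ k) (shallow-block k)

-- A pair (p, q) with p ≤ k and q < 2^h names the code of q under p unary nodes. The chain length
-- recovers p, and the code recovers q.
dagSize-comb-≥ : ∀ h k → h ≤ 2 ^ suc k → suc k * 2 ^ h ≤ dagSize (comb h k)
dagSize-comb-≥ h k h≤ =
  injective⇒≤dagSize (comb h k) (uncurry node ∘ split) node∘split-injective
    λ x → node∈ (proj₁ (split x)) (proj₂ (split x))
  where
  split : Fin (suc k * 2 ^ h) → Fin (suc k) × Fin (2 ^ h)
  split = remQuot {suc k} (2 ^ h)

  node : Fin (suc k) → Fin (2 ^ h) → Tree
  node p q = chain (toℕ p) (code k (toℕ q))

  node∈ : ∀ p q → node p q ∈ subtrees (comb h k)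
  node∈ p q = ∈-subtrees-perfect h (block k) (toℕ q) (toℕ<n q)
    (chain∈subtrees (code k (toℕ q)) (≤⇒≤′ (s≤s⁻¹ (toℕ<n p))))

  node-injective : ∀ {p q p′ q′} → node p q ≡ node p′ q′ → (p , q) ≡ (p′ , q′)
  node-injective {p} {q} {p′} {q′} eq with chain-c-injective (toℕ p) (toℕ p′) eq
  ... | p≡p′ , code≡ = cong₂ _,_ (toℕ-injective p≡p′)
    (toℕ-injective (code-injective h k h≤ (toℕ<n q) (toℕ<n q′) code≡))

  node∘split-injective : Injective _≡_ _≡_ (uncurry node ∘ split)
  node∘split-injective {x} {y} eq = trans (sym (combine-remQuot {suc k} (2 ^ h) x))
    (trans (cong (uncurry combine) (node-injective eq)) (combine-remQuot {suc k} (2 ^ h) y))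

-- Choice of the parameters and asymptotic bounds

loglog : ℕ → ℕ
loglog n = ⌊log₂ ⌊log₂ n ⌋ ⌋

height : ℕ → ℕ
height n = ⌊log₂ n ⌋ ∸ loglog n

tree : ℕ → Tree
tree n = comb (height n) (loglog n)

module _ {n} (2≤n : 2 ≤ n) where
  private
    L = ⌊log₂ n ⌋
    k = loglog n
    h = height n

  2^k≤L : 2 ^ k ≤ L
  2^k≤L = 2^⌊log₂n⌋≤n L (⌊log₂⌋-mono-≤ 2≤n)

  -- The truncated subtraction in `height` is exact because k < 2^k ≤ L.
  2^h*2^k : 2 ^ h * 2 ^ k ≡ 2 ^ L
  2^h*2^k = trans (sym (^-distribˡ-+-* 2 h k))
    (cong (2 ^_) (m∸n+n≡m (<⇒≤ (<-≤-trans (n<2^n k) 2^k≤L))))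

  2^L≤n : 2 ^ L ≤ n
  2^L≤n = 2^⌊log₂n⌋≤n n (≤-trans z<s 2≤n)

  tree-size-≥ : n ≤ size (tree n)
  tree-size-≥ = s≤s⁻¹ (begin
    suc n                      ≤⟨ n<2^1+⌊log₂n⌋ n ⟩
    2 * 2 ^ L                  ≤⟨ m≤n*m (2 * 2 ^ L) 2 ⟩
    2 * (2 * 2 ^ L)            ≡⟨ cong (λ x → 2 * (2 * x)) 2^h*2^k ⟨
    2 * (2 * (2 ^ h * 2 ^ k))  ≡⟨ lemma (2 ^ h) (2 ^ k) ⟩
    2 ^ h * 2 ^ (2 + k)        ≤⟨ size-perfect-≥ h _ (block k) (size-block-≥ k) ⟩
    suc (size (tree n))        ∎)
    where
    open ≤-Reasoning
    lemma : ∀ x y → 2 * (2 * (x * y)) ≡ x * (2 * (2 * y))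
    lemma = solve-∀

  tree-size-≤ : size (tree n) ≤ 7 * n
  tree-size-≤ = begin
    size (tree n)        ≤⟨ n≤1+n _ ⟩
    suc (size (tree n))  ≤⟨ size-perfect-≤ h _ (block k) (size-block-≤ k) ⟩
    2 ^ h * (7 * 2 ^ k)  ≡⟨ lemma (2 ^ h) (2 ^ k) ⟩
    7 * (2 ^ h * 2 ^ k)  ≡⟨ cong (7 *_) 2^h*2^k ⟩
    7 * 2 ^ L            ≤⟨ *-monoʳ-≤ 7 2^L≤n ⟩
    7 * n                ∎
    where
    open ≤-Reasoning
    lemma : ∀ x y → x * (7 * y) ≡ 7 * (x * y)
    lemma = solve-∀

  -- With y = p′/q′ ≤ k + 1, z = r/s ≥ L ≥ 2^k and n < 2 · 2^h · 2^k, the product n · y is at most 2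
  -- · (k + 1) · 2^h · z, and (k + 1) · 2^h bounds the dag size from below.
  tree-dagSize-≥ : n ·loglog n ≤ (2 * dagSize (tree n)) ·log n
  tree-dagSize-≥ (p / q) (p′ / q′) (r / s) x≤ y≤ ≤z = begin
    n * p′ * s                                 ≤⟨ *-monoˡ-≤ s (*-mono-≤ n≤ p′≤) ⟩
    2 * (2 ^ h * 2 ^ k) * (suc k * q′) * s     ≡⟨ lemma (2 ^ h) (2 ^ k) (suc k) q′ s ⟩
    2 * (suc k * 2 ^ h) * (2 ^ k * s) * q′     ≤⟨ *-monoˡ-≤ q′
                                                    (*-mono-≤ (*-monoʳ-≤ 2 D≥) 2^k*s≤r) ⟩
    2 * dagSize (tree n) * r * q′              ∎
    where
    open ≤-Reasoning
    lemma : ∀ x y z q s → 2 * (x * y) * (z * q) * s ≡ 2 * (z * x) * (y * s) * q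
    lemma = solve-∀
    n≤ : n ≤ 2 * (2 ^ h * 2 ^ k)
    n≤ = ≤-trans (<⇒≤ (n<2^1+⌊log₂n⌋ n)) (≤-reflexive (cong (2 *_) (sym 2^h*2^k)))
    p≤ : p ≤ suc L * q
    p≤ = ≤log₂⇒≤ (suc L) x≤
      (≤-trans (<⇒≤ (n<2^1+⌊log₂n⌋ n)) (≤-reflexive (sym (*-identityʳ (2 ^ suc L)))))
    p′≤ : p′ ≤ suc k * q′
    -- The strict bound L < 2^(k+1) absorbs the rounding: x ≤ L + 1 ≤ 2^(k+1).
    p′≤ = ≤log₂⇒≤ (suc k) y≤ (≤-trans p≤ (*-monoˡ-≤ q (n<2^1+⌊log₂n⌋ L)))
    2^k*s≤r : 2 ^ k * s ≤ r
    2^k*s≤r = ≤-trans (*-monoˡ-≤ s 2^k≤L)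
      (log₂≤⇒≤ L ≤z (≤-trans (≤-reflexive (*-identityʳ (2 ^ L))) 2^L≤n))
    D≥ : suc k * 2 ^ h ≤ dagSize (tree n)
    D≥ = dagSize-comb-≥ h k (≤-trans (m∸n≤m L k) (<⇒≤ (n<2^1+⌊log₂n⌋ L)))

mainTheorem8 : Σ[ t ∈ (ℕ → Tree) ] Σ[ C ∈ ℕ ] 0 < C
    × (λ n → size (t n)) ∈Θ (λ n → n)
    × (∀ n → 1 ≤ n → ∀ s → s ∈ subtrees (t n) → depth s ≤ C ·log₂ suc (size s))
    × (λ n → dagSize (t n)) ∈Ω[n·loglog-n/log-n]
mainTheorem8 = tree , 2 , z<s
  -- The threshold 2 ensures L ≥ 1, as needed for 2^k ≤ L; 7 comes from `size-block-≤`.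
  , (1 , 7 , 2 , z<s , z<s , λ n 2≤n →
      ≤-trans (tree-size-≥ 2≤n) (≤-reflexive (sym (*-identityˡ _))) , tree-size-≤ 2≤n)
  , (λ n _ s → All.lookup (shallow-comb (height n) (loglog n)))
  -- The first 2 is the loss from rounding n down to 2^L.
  , (2 , 2 , z<s , λ n → tree-dagSize-≥)
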